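{- For every integer $n\ge 1$, the number of two-ball spherical siteswap sequences $t_1t_2\ldots t_n$ of length $n$ with a throw made at each time step (i.e. $t_i\ge 1$ for all $i$) equals $a_2(n)$, the number of necklaces on $n$ black and white beads such that (i) there is at least one black bead; (ii) between any two (cyclically consecutive) black beads there is an even number of white beads; and (iii) rotations and flippings of necklaces are considered distinct. Moreover, with $a_2(0)=0$ and $a_2(1)=1$, these numbers satisfy $$a_2(n)=a_2(n-1)+a_2(n-2)+1-(-1)^n\qquad (n\ge 2),$$ i.e. they are the associated Mersenne numbers.
   Context: A siteswap sequence of length (period) $n$ is a sequence $t_1t_2\ldots t_n$ of nonnegative integers such that the residues $i+t_i \pmod n$, $1\le i\le n$, are pairwise distinct. Its number of balls is the integer $(t_1+\cdots+t_n)/n$; thus a two-ball siteswap sequence has $t_1+\cdots+t_n=2n$. A spherical siteswap sequence of length $n$ is a siteswap sequence $t_1t_2\ldots t_n$ for which, in addition, the values $i+(t_i/2) \pmod n$ (rational numbers taken modulo $n$), over those $i$ with $t_i\ne 0$, are pairwise distinct. Rotations of a sequence are considered distinct, and sequences of length $n$ are counted whether or not $n$ is their minimal period. A necklace on $n$ beads is a coloring, black or white, of the $n$ labelled positions $1,\ldots,n$ arranged cyclically. Condition (ii) is read cyclically: for each black bead, the number of white beads strictly between it and the next black bead clockwise must be even; if there is exactly one black bead, there are $n-1$ white beads between it and itself, so $n-1$ must be even. The associated Mersenne numbers are the sequence $0,1,1,4,5,11,16,29,45,76,\ldots$ (OEIS A001350) determined by the initial values $0,1$ (indices $0,1$) and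 the displayed recurrence. -}

module Defs where

open import Data.Fin.Base using (Fin; toℕ)
open import Data.Fin.Properties using (all?; any?; nonZeroIndex)
open import Data.Integer.Base as ℤ using (ℤ; +_; 0ℤ; 1ℤ; -1ℤ)
open import Data.List.Base as List using (List; _∷_; []; _++_; length; filter)
open import Data.List.Membership.Propositional using (_∈_)
open import Data.List.Membership.Propositional.Properties
  using (∈-filter⁺; ∈-filter⁻; ∈-map⁺; ∈-map⁻; ∈-++⁺ˡ; ∈-++⁺ʳ)
open import Data.List.Relation.Unary.Any using (here)
open import Data.List.Relation.Unary.Unique.Propositional using (Unique; []; _∷_)
import Data.List.Relation.Unary.All as All
import Data.List.Relation.Unary.Unique.Propositional.Properties as Unique
open import Data.Nat.Base using (ℕ; zero; suc; _+_; _*_; _≥_; NonZero)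
open import Data.Nat.Divisibility using (_∣_; _∣?_)
open import Data.Nat.DivMod using (_%_; _mod_)
open import Data.Product.Base using (Σ-syntax; ∃-syntax; _×_; _,_; proj₁; proj₂)
open import Data.Rational.Base as ℚ using (ℚ)
open import Data.Vec.Base using (Vec; []; _∷_; lookup; sum)
open import Data.Vec.Properties using (∷-injectiveˡ; ∷-injectiveʳ)
open import Function.Bundles using (_⇔_; mk⇔)
open import Function.Definitions using (Injective)
open import Level using (Level)
open import Relation.Binary.PropositionalEquality using (_≡_; _≢_; refl; sym; trans)
open import Relation.Nullary.Decidable using (Dec; yes; no; _×-dec_; _→-dec_)
open import Relation.Unary using (Pred; Decidable)

private
  variable
    a p : Level
    n : ℕ

record Enumeration {A : Set a} (P : Pred A p) : Set (a Level.⊔ p) where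
  field
    elements : List A
    unique   : Unique elements
    exact    : ∀ x → x ∈ elements ⇔ P x

  size : ℕ
  size = length elements

open Enumeration public

HasCardinality : {A : Set a} → Pred A p → ℕ → Set (a Level.⊔ p)
HasCardinality P k = Σ[ e ∈ Enumeration P ] size e ≡ k

-- Times are 1, …, n, while Fin n starts from 0.
time : Fin n → ℕ
time i = suc (toℕ i)

landing : .{{_ : NonZero n}} → Vec ℕ n → Fin n → ℕ
landing {n} t i = (time i + lookup t i) % n

IsSiteswap : .{{_ : NonZero n}} → Vec ℕ n → Set
IsSiteswap t = Injective _≡_ _≡_ (landing t)

midpoint : Vec ℕ n → Fin n → ℚ
midpoint t i = (+ time i) ℚ./ 1 ℚ.+ (+ lookup t i) ℚ./ 2

-- Congruence of rationals: x - y is an integer multiple of n.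
infix 4 _≡_[mod_]
_≡_[mod_] : ℚ → ℚ → ℕ → Set
x ≡ y [mod n ] = ∃[ k ] x ℚ.- y ≡ (k ℤ.* + n) ℚ./ 1

record IsSphericalSiteswap .{{_ : NonZero n}} (t : Vec ℕ n) : Set where
  field
    siteswap  : IsSiteswap t
    spherical : ∀ i j → lookup t i ≢ 0 → lookup t j ≢ 0 →
                midpoint t i ≡ midpoint t j [mod n ] → i ≡ j

HasBalls : ℕ → Vec ℕ n → Set
HasBalls {n} b t = sum t ≡ b * n

ThrowsAtEachStep : Vec ℕ n → Set
ThrowsAtEachStep t = ∀ i → lookup t i ≥ 1

data Colour : Set where
  black white : Colour

_≟ᶜ_ : (c d : Colour) → Dec (c ≡ d)
black ≟ᶜ black = yes refl
black ≟ᶜ white = no λ ()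
white ≟ᶜ black = no λ ()
white ≟ᶜ white = yes refl

-- The bead reached by moving m steps clockwise from i.
infixl 6 _↻_
_↻_ : Fin n → ℕ → Fin n
_↻_ {n} i m = (toℕ i + m) mod n
  where instance _ = nonZeroIndex i

-- From the black bead i, the next black bead clockwise is reached after
-- passing exactly d white beads.  It may be i itself, with d = n - 1.
record BlackGap (c : Vec Colour n) (i : Fin n) (d : ℕ) : Set where
  constructor blackGap
  field
    start : lookup c i ≡ black
    whites : ∀ (k : Fin d) → lookup c (i ↻ suc (toℕ k)) ≡ white
    end   : lookup c (i ↻ suc d) ≡ black

-- There are fewer than n white beads in a gap, so d ranges over Fin n.
record IsEvenNecklace (c : Vec Colour n) : Set where
  constructor evenNecklace
  field
    someBlack : ∃[ i ] lookup c i ≡ black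
    evenGaps  : ∀ (i d : Fin n) → BlackGap c i (toℕ d) → 2 ∣ toℕ d

blackGap? : (c : Vec Colour n) (i : Fin n) (d : ℕ) → Dec (BlackGap c i d)
blackGap? c i d
  with (lookup c i ≟ᶜ black)
       ×-dec all? (λ (k : Fin d) → lookup c (i ↻ suc (toℕ k)) ≟ᶜ white)
       ×-dec (lookup c (i ↻ suc d) ≟ᶜ black)
... | yes (s , w , e) = yes (blackGap s w e)
... | no ¬g = no λ (blackGap s w e) → ¬g (s , w , e)

isEvenNecklace? : Decidable (IsEvenNecklace {n})
isEvenNecklace? c
  with any? (λ i → lookup c i ≟ᶜ black)
       ×-dec all? (λ i → all? (λ d →
               blackGap? c i (toℕ d) →-dec (2 ∣? toℕ d)))
... | yes (b , g) = yes (evenNecklace b g)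
... | no ¬p = no λ (evenNecklace b g) → ¬p (b , g)

colourings : ∀ n → List (Vec Colour n)
colourings zero    = [] ∷ []
colourings (suc n) = List.map (black ∷_) (colourings n)
                  ++ List.map (white ∷_) (colourings n)

colourings-unique : ∀ n → Unique (colourings n)
colourings-unique zero    = All.[] ∷ []
colourings-unique (suc n) =
  Unique.++⁺ (Unique.map⁺ ∷-injectiveʳ (colourings-unique n))
             (Unique.map⁺ ∷-injectiveʳ (colourings-unique n))
             λ (x∈bs , x∈ws) → disjoint (∈-map⁻ _ x∈bs) (∈-map⁻ _ x∈ws)
  where
  disjoint : ∀ {x} →
             ∃[ y ] (y ∈ colourings n × x ≡ black ∷ y) →
             ∃[ z ] (z ∈ colourings n × x ≡ white ∷ z) → _
  disjoint (_ , _ , x≡b) (_ , _ , x≡w) with () ← ∷-injectiveˡ (trans (sym x≡b) x≡w)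

colourings-complete : (c : Vec Colour n) → c ∈ colourings n
colourings-complete []          = here refl
colourings-complete (black ∷ c) = ∈-++⁺ˡ (∈-map⁺ _ (colourings-complete c))
colourings-complete (white ∷ c) = ∈-++⁺ʳ _ (∈-map⁺ _ (colourings-complete c))

evenNecklaces : ∀ n → Enumeration (IsEvenNecklace {n})
evenNecklaces n .elements = filter isEvenNecklace? (colourings n)
evenNecklaces n .unique   = Unique.filter⁺ isEvenNecklace? (colourings-unique n)
evenNecklaces n .exact c  = mk⇔
  (λ c∈ → proj₂ (∈-filter⁻ isEvenNecklace? {xs = colourings n} c∈))
  (∈-filter⁺ isEvenNecklace? (colourings-complete c))

a₂ : ℕ → ℕ
a₂ n = size (evenNecklaces n)

-- OEIS A001350.
associatedMersenne : ℕ → ℤ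
associatedMersenne zero = 0ℤ
associatedMersenne (suc zero) = 1ℤ
associatedMersenne (suc (suc n)) =
  associatedMersenne (suc n) ℤ.+ associatedMersenne n
    ℤ.+ 1ℤ ℤ.- -1ℤ ℤ.^ suc (suc n)

{-# OPTIONS --safe #-}

-- A white bead at time i encodes a throw of height 1, and a black bead followed by d white ones
-- encodes a throw of height 2 + d; conversely a throw is black exactly when its height is at
-- least 2.  If d k is the distance from k to the first black bead at or after k, then in both
-- cases height k + d k = 2 + d (k + 1), so the heights of one period sum to 2n.
--
-- Given a siteswap with positive throws, a throw followed by d white beads and of height between
-- 2 and d + 1 would land together with one of those white beads.  So black throws have height at
-- least 2 + d, and as both sequences have sum 2n they agree.  A gap of odd length 2m + 1 would
-- make the throw share its midpoint with the (m + 1)-st white bead after it, so sphericity forces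
-- the gaps to be even.
--
-- Even necklaces with a black bead are the closed walks containing a black step on the graph with
-- states the two parities, a black loop at 0 and white edges in both directions between 0 and 1.
-- All closed walks satisfy the Fibonacci recurrence, and all-white ones are easily subtracted.
module Submission where

open import Defs
open import Data.Bool.Base using (true; false)
open import Data.Fin.Base using (Fin; zero; suc; toℕ; fromℕ<)
open import Data.Fin.Properties using (toℕ-injective; toℕ-fromℕ<; toℕ<n)
open import Data.Integer.Base as ℤ using (ℤ; +_; -[1+_]; 1ℤ; -1ℤ)
import Data.Integer.Properties as ℤ
import Data.Integer.Tactic.RingSolver as ℤ-Solver
open import Data.List.Base as List using ([]; _∷_; _++_; filter; length)
open import Data.List.Membership.Propositional using (_∈_)
open import Data.List.Membership.Propositional.Properties using (∈-map⁺; ∈-map⁻)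
open import Data.List.Properties using (filter-++; filter-≐; filter-none; length-++; length-map)
import Data.List.Relation.Unary.All as All
import Data.List.Relation.Unary.Unique.Propositional.Properties as Unique
open import Data.Nat.Base
open import Data.Nat.DivMod
open import Data.Nat.Divisibility
open import Data.Nat.Properties
import Data.Nat.Tactic.RingSolver as ℕ-Solver
open import Data.Parity.Base using (Parity; 0ℙ; 1ℙ; _⁻¹)
open import Data.Parity.Properties using (suc-homo-⁻¹; ⁻¹-injective)
open import Data.Product.Base using (∃-syntax; _×_; _,_; proj₁; proj₂)
open import Data.Rational.Base as ℚ using (ℚ; toℚᵘ)
import Data.Rational.Properties as ℚ
open import Data.Rational.Unnormalised.Base as ℚᵘ using (mkℚᵘ; *≡*; _≃_)
import Data.Rational.Unnormalised.Properties as ℚᵘ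
open import Data.Sum.Base using (_⊎_; inj₁; inj₂)
open import Data.Vec.Base using (Vec; []; _∷_; lookup; map; sum; tabulate)
open import Data.Vec.Properties
  using (lookup-map; lookup∘tabulate; tabulate-cong; tabulate∘lookup)
open import Function.Base using (_∘_)
open import Function.Bundles using (mk⇔; module Equivalence)
open import Level using (0ℓ)
open import Relation.Binary.Definitions using (tri<; tri≈; tri>)
open import Relation.Binary.PropositionalEquality
open import Relation.Nullary.Decidable using (yes; no; does; _⊎-dec_)
open import Relation.Nullary.Negation using (¬_; contradiction)
open import Relation.Unary using (Pred; Decidable; _≐_)

private
  variable
    n d k l h : ℕ
    r s : Parity
    f : ℕ → Colour
    A : Set

-- Counting closed walks

length-filter-map : ∀ {A B : Set} {P : Pred B 0ℓ} (P? : Decidable P) (f : A → B) xs →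
                    length (filter P? (List.map f xs)) ≡ length (filter (P? ∘ f) xs)
length-filter-map P? f []       = refl
length-filter-map P? f (x ∷ xs) with does (P? (f x))
... | true  = cong suc (length-filter-map P? f xs)
... | false = length-filter-map P? f xs

length-filter-∪ : ∀ {A : Set} {P Q : Pred A 0ℓ} (P? : Decidable P) (Q? : Decidable Q) →
                  (∀ {x} → P x → ¬ Q x) → ∀ xs →
                  length (filter (λ x → P? x ⊎-dec Q? x) xs)
                    ≡ length (filter P? xs) + length (filter Q? xs)
length-filter-∪ P? Q? disjoint []       = refl
length-filter-∪ P? Q? disjoint (x ∷ xs) with P? x | Q? x
... | yes p | yes q = contradiction q (disjoint p)
... | yes _ | no  _ = cong suc (length-filter-∪ P? Q? disjoint xs)
... | no  _ | yes _ = trans (cong suc (length-filter-∪ P? Q? disjoint xs)) (sym (+-suc _ _))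
... | no  _ | no  _ = length-filter-∪ P? Q? disjoint xs

count : {P : Pred (Vec Colour n) 0ℓ} → Decidable P → ℕ
count {n = n} P? = length (filter P? (colourings n))

count-cong : {P Q : Pred (Vec Colour n) 0ℓ} (P? : Decidable P) (Q? : Decidable Q) →
             P ≐ Q → count P? ≡ count Q?
count-cong {n = n} P? Q? P≐Q = cong length (filter-≐ P? Q? P≐Q (colourings n))

count-none : {P : Pred (Vec Colour n) 0ℓ} (P? : Decidable P) → (∀ c → ¬ P c) → count P? ≡ 0
count-none {n = n} P? ¬P = cong length (filter-none P? {colourings n} (All.tabulate λ {c} _ → ¬P c))

count-suc : {P : Pred (Vec Colour (suc n)) 0ℓ} (P? : Decidable P) →
            count P? ≡ count (P? ∘ (black ∷_)) + count (P? ∘ (white ∷_))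
count-suc {n = n} P? = begin
  length (filter P? (List.map (black ∷_) cs ++ List.map (white ∷_) cs))
    ≡⟨ cong length (filter-++ P? (List.map (black ∷_) cs) _) ⟩
  length (filter P? (List.map (black ∷_) cs) ++ filter P? (List.map (white ∷_) cs))
    ≡⟨ length-++ (filter P? (List.map (black ∷_) cs)) ⟩
  length (filter P? (List.map (black ∷_) cs)) + length (filter P? (List.map (white ∷_) cs))
    ≡⟨ cong₂ _+_ (length-filter-map P? (black ∷_) cs) (length-filter-map P? (white ∷_) cs) ⟩
  count (P? ∘ (black ∷_)) + count (P? ∘ (white ∷_)) ∎
  where
  open ≡-Reasoning
  cs = colourings n

-- The state is the parity of the number of white beads still to come before the next black one.
-- Walk r s c reads c starting in state s and ending in state r.
data Step : Parity → Colour → Parity → Set where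
  black : Step 0ℙ black 0ℙ
  white : Step s white (s ⁻¹)

data Walk (r : Parity) : Parity → Vec Colour n → Set where
  done  : Walk r r []
  black : {c : Vec Colour n} → Walk r 0ℙ c → Walk r 0ℙ (black ∷ c)
  white : {c : Vec Colour n} → Walk r (s ⁻¹) c → Walk r s (white ∷ c)

-- The constructor `black` marks the first black step, and an unrestricted walk may follow it. This
-- is why `#walks` enters the recursion of `#blackWalks`.
data BlackWalk (r : Parity) : Parity → Vec Colour n → Set where
  black : {c : Vec Colour n} → Walk r 0ℙ c → BlackWalk r 0ℙ (black ∷ c)
  white : {c : Vec Colour n} → BlackWalk r (s ⁻¹) c → BlackWalk r s (white ∷ c)

walk? : ∀ r s → Decidable (Walk r {n} s)
walk? 0ℙ 0ℙ []         = yes done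
walk? 0ℙ 1ℙ []         = no λ ()
walk? 1ℙ 0ℙ []         = no λ ()
walk? 1ℙ 1ℙ []         = yes done
walk? r  1ℙ (black ∷ c) = no λ ()
walk? r  0ℙ (black ∷ c) with walk? r 0ℙ c
... | yes w = yes (black w)
... | no ¬w = no λ { (black w) → ¬w w }
walk? r  s (white ∷ c) with walk? r (s ⁻¹) c
... | yes w = yes (white w)
... | no ¬w = no λ { (white w) → ¬w w }

blackWalk? : ∀ r s → Decidable (BlackWalk r {n} s)
blackWalk? r s  []          = no λ ()
blackWalk? r 1ℙ (black ∷ c) = no λ ()
blackWalk? r 0ℙ (black ∷ c) with walk? r 0ℙ c
... | yes w = yes (black w)
... | no ¬w = no λ { (black w) → ¬w w }
blackWalk? r s  (white ∷ c) with blackWalk? r (s ⁻¹) c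
... | yes w = yes (white w)
... | no ¬w = no λ { (white w) → ¬w w }

#walks #blackWalks : Parity → Parity → ℕ → ℕ
#walks      r s n = count (walk? {n} r s)
#blackWalks r s n = count (blackWalk? {n} r s)

-- Peeling off the first bead gives a transfer matrix with rows (1, 1) and (1, 0), the Fibonacci
-- matrix.
#walks-even : ∀ r n → #walks r 0ℙ (suc n) ≡ #walks r 0ℙ n + #walks r 1ℙ n
#walks-even r n = trans (count-suc {n} (walk? r 0ℙ)) (cong₂ _+_
  (count-cong {n} (walk? r 0ℙ ∘ (black ∷_)) (walk? r 0ℙ) ((λ { (black w) → w }) , black))
  (count-cong {n} (walk? r 0ℙ ∘ (white ∷_)) (walk? r 1ℙ) ((λ { (white w) → w }) , white)))

#walks-odd : ∀ r n → #walks r 1ℙ (suc n) ≡ #walks r 0ℙ n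
#walks-odd r n = trans (count-suc {n} (walk? r 1ℙ)) (cong₂ _+_
  (count-none {n} (walk? r 1ℙ ∘ (black ∷_)) λ _ ())
  (count-cong {n} (walk? r 1ℙ ∘ (white ∷_)) (walk? r 0ℙ) ((λ { (white w) → w }) , white)))

#blackWalks-even : ∀ r n → #blackWalks r 0ℙ (suc n) ≡ #walks r 0ℙ n + #blackWalks r 1ℙ n
#blackWalks-even r n = trans (count-suc {n} (blackWalk? r 0ℙ)) (cong₂ _+_
  (count-cong {n} (blackWalk? r 0ℙ ∘ (black ∷_)) (walk? r 0ℙ) ((λ { (black w) → w }) , black))
  (count-cong {n} (blackWalk? r 0ℙ ∘ (white ∷_)) (blackWalk? r 1ℙ) ((λ { (white w) → w }) , white)))

#blackWalks-odd : ∀ r n → #blackWalks r 1ℙ (suc n) ≡ #blackWalks r 0ℙ n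
#blackWalks-odd r n = trans (count-suc {n} (blackWalk? r 1ℙ)) (cong₂ _+_
  (count-none {n} (blackWalk? r 1ℙ ∘ (black ∷_)) λ _ ())
  (count-cong {n} (blackWalk? r 1ℙ ∘ (white ∷_)) (blackWalk? r 0ℙ) ((λ { (white w) → w }) , white)))

-- Each white bead keeps the two states opposite, but the first black bead can be read only in state
-- 0. Hence no colouring is counted from both starting states.
blackWalk-disjoint : ∀ {r r′} {c : Vec Colour n} → BlackWalk r 0ℙ c → ¬ BlackWalk r′ 1ℙ c
blackWalk-disjoint (white v) (white w) = blackWalk-disjoint w v

-- `#closedWalks n` is the trace of the n-th power of the transfer matrix: the Lucas numbers 2, 1,
-- 3, 4, 7, and so on.
#closedWalks #closedBlackWalks : ℕ → ℕ
#closedWalks      n = #walks 0ℙ 0ℙ n + #walks 1ℙ 1ℙ n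
#closedBlackWalks n = #blackWalks 0ℙ 0ℙ n + #blackWalks 1ℙ 1ℙ n

#closedWalks-rec : ∀ n → #closedWalks (2 + n) ≡ #closedWalks (1 + n) + #closedWalks n
#closedWalks-rec n
  rewrite #walks-even 0ℙ (suc n) | #walks-odd 0ℙ n
        | #walks-odd 1ℙ (suc n) | #walks-even 1ℙ n | #walks-odd 1ℙ n
  = lemma (#walks 0ℙ 0ℙ (suc n)) (#walks 0ℙ 0ℙ n) (#walks 1ℙ 0ℙ n) (#walks 1ℙ 1ℙ n)
  where
  lemma : ∀ w x y z → w + x + (y + z) ≡ w + y + (x + z)
  lemma = ℕ-Solver.solve-∀

-- Dropping two initial white steps returns to the same state and keeps a black step, which gives
-- the last summand. Otherwise the first black step is the first or the second one and an arbitrary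
-- walk follows; these walks together are as many as the closed ones of length `1 + n`.
#closedBlackWalks-rec : ∀ n → #closedBlackWalks (2 + n) ≡ #closedWalks (1 + n) + #closedBlackWalks n
#closedBlackWalks-rec n
  rewrite #blackWalks-even 0ℙ (suc n) | #blackWalks-odd 0ℙ n
        | #blackWalks-odd 1ℙ (suc n) | #blackWalks-even 1ℙ n | #walks-odd 1ℙ n
  = lemma (#walks 0ℙ 0ℙ (suc n)) (#blackWalks 0ℙ 0ℙ n) (#walks 1ℙ 0ℙ n) (#blackWalks 1ℙ 1ℙ n)
  where
  lemma : ∀ w x y z → w + x + (y + z) ≡ w + y + (x + z)
  lemma = ℕ-Solver.solve-∀

-- A white walk alternates between the states, so it closes up from either one or from neither.
#closedWhiteWalks : ℕ → ℕ
#closedWhiteWalks 0             = 2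
#closedWhiteWalks 1             = 0
#closedWhiteWalks (suc (suc n)) = #closedWhiteWalks n

-- From `n` to `2 + n` both `#closedWalks` and `#closedBlackWalks` grow by `#closedWalks (1 + n)`,
-- so their difference has period two and is fixed by its values at 0 and 1.
#closedWalks-split : ∀ n → #closedWalks n ≡ #closedBlackWalks n + #closedWhiteWalks n
#closedWalks-split 0 = refl
#closedWalks-split 1 = refl
#closedWalks-split (suc (suc n)) = begin
  #closedWalks (2 + n)                                               ≡⟨ #closedWalks-rec n ⟩
  #closedWalks (1 + n) + #closedWalks n                              ≡⟨ cong₂ _+_ (refl {x = #closedWalks (1 + n)}) (#closedWalks-split n) ⟩
  #closedWalks (1 + n) + (#closedBlackWalks n + #closedWhiteWalks n) ≡⟨ +-assoc (#closedWalks (1 + n)) _ _ ⟨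
  #closedWalks (1 + n) + #closedBlackWalks n + #closedWhiteWalks n   ≡⟨ cong₂ _+_ (#closedBlackWalks-rec n) (refl {x = #closedWhiteWalks n}) ⟨
  #closedBlackWalks (2 + n) + #closedWhiteWalks n                    ∎
  where open ≡-Reasoning

+#closedWhiteWalks : ∀ n → + #closedWhiteWalks n ≡ 1ℤ ℤ.+ -1ℤ ℤ.^ n
+#closedWhiteWalks 0 = refl
+#closedWhiteWalks 1 = refl
+#closedWhiteWalks (suc (suc n)) = trans (+#closedWhiteWalks n) (lemma (-1ℤ ℤ.^ n))
  where
  lemma : ∀ x → 1ℤ ℤ.+ x ≡ 1ℤ ℤ.+ -1ℤ ℤ.* (-1ℤ ℤ.* x)
  lemma = ℤ-Solver.solve-∀

-- The inhomogeneous term counts the all-white closed walks of length `1 + n`, since 1 + (-1)^(1 +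
-- n) = 1 - (-1)^(2 + n).
+#closedBlackWalks-rec : ∀ n → + #closedBlackWalks (2 + n) ≡
  + #closedBlackWalks (1 + n) ℤ.+ + #closedBlackWalks n ℤ.+ 1ℤ ℤ.- -1ℤ ℤ.^ (2 + n)
+#closedBlackWalks-rec n = begin
  + #closedBlackWalks (2 + n)
    ≡⟨ cong +_ (trans (#closedBlackWalks-rec n) (cong₂ _+_ (#closedWalks-split (suc n)) refl)) ⟩
  + #closedBlackWalks (1 + n) ℤ.+ + #closedWhiteWalks (1 + n) ℤ.+ + #closedBlackWalks n
    ≡⟨ cong (λ w → + #closedBlackWalks (1 + n) ℤ.+ w ℤ.+ + #closedBlackWalks n) (+#closedWhiteWalks (suc n)) ⟩
  + #closedBlackWalks (1 + n) ℤ.+ (1ℤ ℤ.+ -1ℤ ℤ.^ (1 + n)) ℤ.+ + #closedBlackWalks n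
    ≡⟨ lemma (+ #closedBlackWalks (suc n)) (+ #closedBlackWalks n) (-1ℤ ℤ.^ n) ⟩
  + #closedBlackWalks (1 + n) ℤ.+ + #closedBlackWalks n ℤ.+ 1ℤ ℤ.- -1ℤ ℤ.^ (2 + n) ∎
  where
  open ≡-Reasoning
  lemma : ∀ x y z → x ℤ.+ (1ℤ ℤ.+ -1ℤ ℤ.* z) ℤ.+ y ≡ x ℤ.+ y ℤ.+ 1ℤ ℤ.- -1ℤ ℤ.* (-1ℤ ℤ.* z)
  lemma = ℤ-Solver.solve-∀

-- Gaps and throws along an infinite sequence of beads

black≢white : ∀ {x : Colour} → x ≡ black → x ≢ white
black≢white refl ()

-- Counting starts at `k` itself, so the gap following a black bead `k` is a `Gap f (suc k) d`.
-- Unlike `BlackGap`, no black bead is required in front, so white positions have gaps too.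
data Gap (f : ℕ → Colour) : ℕ → ℕ → Set where
  stop : f k ≡ black → Gap f k 0
  skip : f k ≡ white → Gap f (suc k) d → Gap f k (suc d)

gap-end : Gap f k d → f (k + d) ≡ black
gap-end {f} {k} (stop b)           = trans (cong f (+-identityʳ k)) b
gap-end {f} {k} (skip {d = d} w g) = trans (cong f (+-suc k d)) (gap-end g)

gap-white : ∀ {j} → Gap f k d → j < d → f (k + j) ≡ white
gap-white {f} {k} {j = zero}  (skip w g) j<d       = trans (cong f (+-identityʳ k)) w
gap-white {f} {k} {j = suc j} (skip w g) (s≤s j<d) = trans (cong f (+-suc k j)) (gap-white g j<d)

gap-intro : ∀ d → (∀ {j} → j < d → f (k + j) ≡ white) → f (k + d) ≡ black → Gap f k d
gap-intro {f} {k} zero    w b = stop (trans (cong f (sym (+-identityʳ k))) b)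
gap-intro {f} {k} (suc d) w b = skip (trans (cong f (sym (+-identityʳ k))) (w z<s))
  (gap-intro d (λ {j} j<d → trans (cong f (sym (+-suc k j))) (w (s≤s j<d)))
               (trans (cong f (sym (+-suc k d))) b))

gap-unique : ∀ {d d′} → Gap f k d → Gap f k d′ → d ≡ d′
gap-unique (stop b)   (stop _)   = refl
gap-unique (stop b)   (skip w _) = contradiction w (black≢white b)
gap-unique (skip w _) (stop b)   = contradiction w (black≢white b)
gap-unique (skip _ g) (skip _ h) = cong suc (gap-unique g h)

gap-minimal : ∀ {m} → Gap f k d → f (k + m) ≡ black → d ≤ m
gap-minimal g b = ≮⇒≥ λ m<d → black≢white b (gap-white g m<d)

gap-exists : ∀ m → f (k + m) ≡ black → ∃[ d ] Gap f k d
gap-exists {f} {k} m b with f k in eq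
gap-exists {f} {k} m b       | black = 0 , stop eq
gap-exists {f} {k} zero b    | white = contradiction eq (black≢white (trans (cong f (sym (+-identityʳ k))) b))
gap-exists {f} {k} (suc m) b | white with d , g ← gap-exists m (trans (cong f (sym (+-suc k m))) b) =
  suc d , skip eq g

gap-shift : (∀ j → f (k + j) ≡ f (l + j)) → Gap f k d → Gap f l d
gap-shift {d = d} eq g = gap-intro d (λ {j} j<d → trans (sym (eq j)) (gap-white g j<d))
                                     (trans (sym (eq d)) (gap-end g))

EvenGaps : (ℕ → Colour) → Set
EvenGaps f = ∀ {k d} → f k ≡ black → Gap f (suc k) d → 2 ∣ d

data Throw (f : ℕ → Colour) (k : ℕ) : ℕ → Set where
  white : f k ≡ white → Throw f k 1
  black : f k ≡ black → Gap f (suc k) d → Throw f k (2 + d)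

throw-unique : ∀ {h h′} → Throw f k h → Throw f k h′ → h ≡ h′
throw-unique (white _)   (white _)   = refl
throw-unique (white w)   (black b _) = contradiction w (black≢white b)
throw-unique (black b _) (white w)   = contradiction w (black≢white b)
throw-unique (black _ g) (black _ h) = cong (_+_ 2) (gap-unique g h)

throw-positive : Throw f k h → h ≥ 1
throw-positive (white _)   = s≤s z≤n
throw-positive (black _ _) = s≤s z≤n

throw-shift : (∀ j → f (k + j) ≡ f (l + j)) → Throw f k h → Throw f l h
throw-shift {f} {k} {l} eq = λ where
    (white w)   → white (trans (sym eq₀) w)
    (black b g) → black (trans (sym eq₀) b) (gap-shift eq₁ g)
  where
  eq₀ : f k ≡ f l
  eq₀ = subst₂ (λ x y → f x ≡ f y) (+-identityʳ k) (+-identityʳ l) (eq 0)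
  eq₁ : ∀ j → f (suc k + j) ≡ f (suc l + j)
  eq₁ j = subst₂ (λ x y → f x ≡ f y) (+-suc k j) (+-suc l j) (eq (suc j))

throw-balance : ∀ {d e} → Gap f k d → Gap f (suc k) e → Throw f k h → h + d ≡ 2 + e
throw-balance (stop b)   g (white w)   = contradiction w (black≢white b)
throw-balance (skip _ g) h (white _)   = cong (_+_ 2) (gap-unique g h)
throw-balance (stop _)   g (black b h) = cong (_+_ 2) (trans (+-identityʳ _) (gap-unique h g))
throw-balance (skip w _) g (black b _) = contradiction w (black≢white b)

gap-before : ∀ {k l d} → f l ≡ black → Gap f (suc k) d → k < l → suc (k + d) ≤ l
gap-before {f} {k} {l} {d} b g k<l =
  subst (suc k + d ≤_) (m+[n∸m]≡n k<l)
    (+-monoʳ-≤ (suc k) (gap-minimal g (trans (cong f (m+[n∸m]≡n k<l)) b)))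

-- A black throw lands one step past the next black bead, hence at `l + 1` or before, while the
-- throw from `l` lands at `l + 2` or later.
black-landing-< : ∀ {d e} → f l ≡ black → Gap f (suc k) d → k < l → k + (2 + d) < l + (2 + e)
black-landing-< {l = l} {k} {d} {e} b g k<l = begin-strict
  k + (2 + d)       ≡⟨ lemma₁ k d ⟩
  1 + suc (k + d)   ≤⟨ s≤s (gap-before b g k<l) ⟩
  1 + l             <⟨ ≤-refl ⟩
  2 + l             ≤⟨ m≤m+n (2 + l) e ⟩
  2 + l + e         ≡⟨ lemma₂ l e ⟩
  l + (2 + e)       ∎
  where
  open ≤-Reasoning
  lemma₁ : ∀ x y → x + (2 + y) ≡ 1 + suc (x + y)
  lemma₁ = ℕ-Solver.solve-∀
  lemma₂ : ∀ x y → 2 + x + y ≡ x + (2 + y)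
  lemma₂ = ℕ-Solver.solve-∀

-- In doubled units, the midpoint of a black throw is no later than the next black bead, and that of
-- the throw from `l` is strictly after `l`.
black-midpoint-< : ∀ {d e} → f l ≡ black → Gap f (suc k) d → k < l → 2 * k + (2 + d) < 2 * l + (2 + e)
black-midpoint-< {l = l} {k} {d} {e} b g k<l = begin-strict
  2 * k + (2 + d)     ≤⟨ m≤m+n _ d ⟩
  2 * k + (2 + d) + d ≡⟨ lemma₁ k d ⟩
  2 * suc (k + d)     ≤⟨ *-monoʳ-≤ 2 (gap-before b g k<l) ⟩
  2 * l               <⟨ m<m+n (2 * l) z<s ⟩
  2 * l + (2 + e)     ∎
  where
  open ≤-Reasoning
  lemma₁ : ∀ x y → 2 * x + (2 + y) + y ≡ 2 * suc (x + y)
  lemma₁ = ℕ-Solver.solve-∀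

-- A white throw landing together with a black one would have to start at the black bead that ends
-- the gap. Two black throws land in the order of their starts.
landing-injective : ∀ {h h′} → Throw f k h → Throw f l h′ → k + h ≡ l + h′ → k ≡ l
landing-injective {k = k} {l} (white _) (white _) eq = +-cancelʳ-≡ 1 k l eq
landing-injective {f} {k} {l} (white w) (black {d = d} b g) eq =
  contradiction w (black≢white (trans (cong f k≡) (gap-end g)))
  where
  k≡ : k ≡ suc l + d
  k≡ = suc-injective (trans (+-comm 1 k) (trans eq (trans (+-suc l _) (cong suc (+-suc l d)))))
landing-injective t@(black _ _) u@(white _) eq = sym (landing-injective u t (sym eq))
landing-injective {k = k} {l} (black b g) (black c h) eq with <-cmp k l
... | tri< k<l _ _ = contradiction eq (<⇒≢ (black-landing-< c g k<l))
... | tri≈ _ k≡l _ = k≡l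
... | tri> _ _ l<k = contradiction (sym eq) (<⇒≢ (black-landing-< b h l<k))

-- Doubled midpoints are odd for white throws and, the gaps being even, even for black ones. Within
-- one colour they are ordered by their starts.
midpoint-injective : ∀ {h h′} → EvenGaps f → Throw f k h → Throw f l h′ → 2 * k + h ≡ 2 * l + h′ → k ≡ l
midpoint-injective {k = k} {l} even (white _) (white _) eq =
  *-cancelˡ-≡ k l 2 (+-cancelʳ-≡ 1 _ _ eq)
midpoint-injective {k = k} {l} even (white _) (black b g) eq =
  contradiction (∣1⇒≡1 (∣m+n∣m⇒∣n (subst (2 ∣_) (sym eq) 2∣rhs) (m∣m*n k))) λ ()
  where
  2∣rhs : 2 ∣ 2 * l + (2 + _)
  2∣rhs = ∣m∣n⇒∣m+n (m∣m*n l) (∣m∣n⇒∣m+n ∣-refl (even b g))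
midpoint-injective even t@(black _ _) u@(white _) eq = sym (midpoint-injective even u t (sym eq))
midpoint-injective {k = k} {l} even (black b g) (black c h) eq with <-cmp k l
... | tri< k<l _ _ = contradiction eq (<⇒≢ (black-midpoint-< c g k<l))
... | tri≈ _ k≡l _ = k≡l
... | tri> _ _ l<k = contradiction (sym eq) (<⇒≢ (black-midpoint-< b h l<k))

-- Even necklaces as closed walks

%-+-congˡ : ∀ {k l} .{{_ : NonZero n}} → k % n ≡ l % n → ∀ j → (k + j) % n ≡ (l + j) % n
%-+-congˡ {n} {k} {l} eq j = begin
  (k + j) % n         ≡⟨ %-distribˡ-+ k j n ⟩
  (k % n + j % n) % n ≡⟨ cong (λ r → (r + j % n) % n) eq ⟩
  (l % n + j % n) % n ≡⟨ %-distribˡ-+ l j n ⟨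
  (l + j) % n         ∎
  where open ≡-Reasoning

suc-% : ∀ k .{{_ : NonZero n}} → suc k % n ≡ suc (k % n) % n
suc-% {n} k = begin
  suc k % n       ≡⟨ cong (_% n) (+-comm 1 k) ⟩
  (k + 1) % n     ≡⟨ %-+-congˡ (sym (m%n%n≡m%n k n)) 1 ⟩
  (k % n + 1) % n ≡⟨ cong (_% n) (+-comm (k % n) 1) ⟩
  suc (k % n) % n ∎
  where open ≡-Reasoning

toℕ-mod : ∀ k n .{{_ : NonZero n}} → toℕ (k mod n) ≡ k % n
toℕ-mod k n = toℕ-fromℕ< (m%n<n k n)

mod-cong : ∀ {k l} .{{_ : NonZero n}} → k % n ≡ l % n → k mod n ≡ l mod n
mod-cong {n} {k} {l} eq = toℕ-injective (trans (toℕ-mod k n) (trans eq (sym (toℕ-mod l n))))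

toℕ-% : .{{_ : NonZero n}} (i : Fin n) → toℕ i % n ≡ toℕ i
toℕ-% i = m<n⇒m%n≡m (toℕ<n i)

mod-toℕ : .{{_ : NonZero n}} (i : Fin n) → toℕ i mod n ≡ i
mod-toℕ {n} i = toℕ-injective (trans (toℕ-mod (toℕ i) n) (toℕ-% i))

infix 8 _⟨_⟩
-- The periodic extension of a vector, along which gaps and throws run past the end of a period.
_⟨_⟩ : .{{_ : NonZero n}} → Vec A n → ℕ → A
_⟨_⟩ {n} v k = lookup v (k mod n)

⟨toℕ⟩ : .{{_ : NonZero n}} (v : Vec A n) (i : Fin n) → v ⟨ toℕ i ⟩ ≡ lookup v i
⟨toℕ⟩ v i = cong (lookup v) (mod-toℕ i)

⟨⟩-cong : .{{_ : NonZero n}} (v : Vec A n) → k % n ≡ l % n → v ⟨ k ⟩ ≡ v ⟨ l ⟩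
⟨⟩-cong v eq = cong (lookup v) (mod-cong eq)

⟨⟩-shift : .{{_ : NonZero n}} (v : Vec A n) → k % n ≡ l % n → ∀ j → v ⟨ k + j ⟩ ≡ v ⟨ l + j ⟩
⟨⟩-shift v eq j = ⟨⟩-cong v (%-+-congˡ eq j)

HasBlack : Vec Colour n → Set
HasBlack c = ∃[ i ] lookup c i ≡ black

module _ .{{_ : NonZero n}} (c : Vec Colour n) where

  gap-after : HasBlack c → ∀ k → ∃[ d ] Gap (c ⟨_⟩) k d
  -- Position `k * n + toℕ i` is a copy of the black bead `i`, and it is not before `k` because `n`
  -- is at least 1.
  gap-after (i , b) k = gap-exists (k * n ∸ k + toℕ i) (begin
    c ⟨ k + (k * n ∸ k + toℕ i) ⟩ ≡⟨ cong (c ⟨_⟩) (+-assoc k _ (toℕ i)) ⟨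
    c ⟨ k + (k * n ∸ k) + toℕ i ⟩ ≡⟨ cong (λ m → c ⟨ m + toℕ i ⟩) (m+[n∸m]≡n (m≤m*n k n)) ⟩
    c ⟨ k * n + toℕ i ⟩           ≡⟨ cong (c ⟨_⟩) (+-comm (k * n) (toℕ i)) ⟩
    c ⟨ toℕ i + k * n ⟩           ≡⟨ ⟨⟩-cong c ([m+kn]%n≡m%n (toℕ i) k n) ⟩
    c ⟨ toℕ i ⟩                   ≡⟨ ⟨toℕ⟩ c i ⟩
    lookup c i                    ≡⟨ b ⟩
    black                         ∎)
    where open ≡-Reasoning

  gap-after-periodic : (b : HasBlack c) → proj₁ (gap-after b n) ≡ proj₁ (gap-after b 0)
  gap-after-periodic b = gap-unique
    (gap-shift (⟨⟩-shift c (trans (n%n≡0 n) (sym (m*n%n≡0 0 n)))) (proj₂ (gap-after b n)))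
    (proj₂ (gap-after b 0))

  -- The bead `k` recurs after `n` steps and ends the gap at the latest. This makes `d` an index in
  -- `Fin n`, as `IsEvenNecklace` demands.
  gap-short : c ⟨ k ⟩ ≡ black → Gap (c ⟨_⟩) (suc k) d → d ≤ pred n
  gap-short {k} b g = gap-minimal g (begin
    c ⟨ suc k + pred n ⟩   ≡⟨ cong (c ⟨_⟩) (+-suc k (pred n)) ⟨
    c ⟨ k + suc (pred n) ⟩ ≡⟨ cong (λ m → c ⟨ k + m ⟩) (suc-pred n) ⟩
    c ⟨ k + n ⟩            ≡⟨ ⟨⟩-cong c ([m+n]%n≡m%n k n) ⟩
    c ⟨ k ⟩                ≡⟨ b ⟩
    black                  ∎)
    where open ≡-Reasoning

  blackGap⇒gap : ∀ {i} → BlackGap c i d → Gap (c ⟨_⟩) (suc (toℕ i)) d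
  blackGap⇒gap {d} {i} (blackGap _ w e) = gap-intro d white′ (at e)
    where
    at : ∀ {j x} → c ⟨ toℕ i + suc j ⟩ ≡ x → c ⟨ suc (toℕ i) + j ⟩ ≡ x
    at {j} = trans (cong (c ⟨_⟩) (sym (+-suc (toℕ i) j)))
    white′ : ∀ {j} → j < d → c ⟨ suc (toℕ i) + j ⟩ ≡ white
    white′ j<d = at (subst (λ m → c ⟨ toℕ i + suc m ⟩ ≡ white) (toℕ-fromℕ< j<d) (w (fromℕ< j<d)))

  gap⇒blackGap : ∀ {i} → lookup c i ≡ black → Gap (c ⟨_⟩) (suc (toℕ i)) d → BlackGap c i d
  gap⇒blackGap {d} {i} b g = blackGap b
    (λ j → trans (cong (c ⟨_⟩) (+-suc (toℕ i) (toℕ j))) (gap-white g (toℕ<n j)))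
    (trans (cong (c ⟨_⟩) (+-suc (toℕ i) d)) (gap-end g))

  evenNecklace⇒evenGaps : IsEvenNecklace c → EvenGaps (c ⟨_⟩)
  evenNecklace⇒evenGaps (evenNecklace _ even) {k} {d} b g =
    subst (2 ∣_) (toℕ-fromℕ< d<n)
      (even (k mod n) (fromℕ< d<n)
        (subst (BlackGap c (k mod n)) (sym (toℕ-fromℕ< d<n))
          (gap⇒blackGap b (gap-shift (⟨⟩-shift c eq) g))))
    where
    d<n : d < n
    d<n = subst (d <_) (suc-pred n) (s≤s (gap-short b g))
    eq : suc k % n ≡ suc (toℕ (k mod n)) % n
    eq = trans (suc-% k) (cong (λ m → suc m % n) (sym (toℕ-mod k n)))

  evenGaps⇒evenNecklace : HasBlack c → EvenGaps (c ⟨_⟩) → IsEvenNecklace c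
  evenGaps⇒evenNecklace b even = evenNecklace b λ i d g →
    even (trans (⟨toℕ⟩ c i) (BlackGap.start g)) (blackGap⇒gap g)

-- Parities of gaps as states of a walk

2∣⇒parity : 2 ∣ d → parity d ≡ 0ℙ
2∣⇒parity (divides zero    refl) = refl
2∣⇒parity (divides (suc q) refl) = 2∣⇒parity (divides q refl)

parity⇒2∣ : ∀ d → parity d ≡ 0ℙ → 2 ∣ d
parity⇒2∣ zero          _  = 2 ∣0
parity⇒2∣ (suc (suc d)) eq = ∣m∣n⇒∣m+n ∣-refl (parity⇒2∣ d eq)

Steps : (ℕ → Colour) → (ℕ → Parity) → Set
Steps f σ = ∀ k → Step (σ k) (f k) (σ (suc k))

step-black : ∀ {x y} → Step s x y → x ≡ black → s ≡ 0ℙ × y ≡ 0ℙ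
step-black black refl = refl , refl

step-white : ∀ {x y} → Step s x y → x ≡ white → y ≡ s ⁻¹
step-white white refl = refl

-- Induction backwards from the next black bead, which is read in state 0; every white bead before
-- it flips the state.
steps-gap : ∀ {σ} → Steps f σ → Gap f k d → σ k ≡ parity d
steps-gap {k = k} st (stop b) = proj₁ (step-black (st k) b)
steps-gap {k = k} {σ = σ} st (skip {d = d} w g) = ⁻¹-injective (begin
  σ k ⁻¹            ≡⟨ step-white (st k) w ⟨
  σ (suc k)         ≡⟨ steps-gap st g ⟩
  parity d          ≡⟨ suc-homo-⁻¹ d ⟨
  parity (suc d) ⁻¹ ∎)
  where open ≡-Reasoning

steps⇒evenGaps : ∀ {σ} → Steps f σ → EvenGaps f
steps⇒evenGaps st {k} b g = parity⇒2∣ _ (trans (sym (steps-gap st g)) (proj₂ (step-black (st k) b)))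

-- At a black bead the evenness of the following gap returns the walk to state 0. At a white bead
-- the gap shrinks by one and its parity flips.
gap-step : ∀ {e} → EvenGaps f → Gap f k d → Gap f (suc k) e → Step (parity d) (f k) (parity e)
gap-step {e = e} even (stop b) h rewrite b | 2∣⇒parity {e} (even b h) = black
gap-step {e = e} even (skip w g) h rewrite w | gap-unique g h =
  subst (Step _ white) (suc-homo-⁻¹ e) white

walk-intro : ∀ {σ} → Steps f σ → (c : Vec Colour n) → (∀ i → f (toℕ i) ≡ lookup c i) → Walk (σ n) (σ 0) c
walk-intro st []      eq = done
walk-intro {σ = σ} st (x ∷ c) eq =
  extend (subst (λ x → Step (σ 0) x (σ 1)) (eq zero) (st 0)) (walk-intro (st ∘ suc) c (eq ∘ suc))
  where
  extend : ∀ {x y} → Step s x y → Walk r y c → Walk r s (x ∷ c)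
  extend black w = black w
  extend white w = white w

walk-states : {c : Vec Colour n} → Walk r s c → ℕ → Parity
walk-states {s = s} w         zero    = s
-- A default value: states are consulted only at indices up to the length of the word.
walk-states {s = s} done      (suc k) = s
walk-states         (black w) (suc k) = walk-states w k
walk-states         (white w) (suc k) = walk-states w k

walk-states-end : {c : Vec Colour n} (w : Walk r s c) → walk-states w n ≡ r
walk-states-end done      = refl
walk-states-end (black w) = walk-states-end w
walk-states-end (white w) = walk-states-end w

walk-step : {c : Vec Colour n} (w : Walk r s c) (i : Fin n) →
            Step (walk-states w (toℕ i)) (lookup c i) (walk-states w (suc (toℕ i)))
walk-step (black w) zero    = black
walk-step (white w) zero    = white
walk-step (black w) (suc i) = walk-step w i
walk-step (white w) (suc i) = walk-step w i

-- A closed walk can be repeated periodically: after the last bead of a period its final state is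
-- the initial one again.
closedWalk-steps : .{{_ : NonZero n}} {c : Vec Colour n} (w : Walk s s c) →
                   Steps (c ⟨_⟩) (λ k → walk-states w (k % n))
closedWalk-steps {n} {s} {c} w k =
  subst₂ (λ p q → Step (walk-states w p) (c ⟨ k ⟩) q) (toℕ-mod k n) next (walk-step w (k mod n))
  where
  open ≡-Reasoning
  wrap : walk-states w (suc (k % n)) ≡ walk-states w (suc (k % n) % n)
  wrap with m≤n⇒m<n∨m≡n (m%n<n k n)
  ... | inj₁ <n = cong (walk-states w) (sym (m<n⇒m%n≡m <n))
  ... | inj₂ ≡n = begin
    walk-states w (suc (k % n))     ≡⟨ cong (walk-states w) ≡n ⟩
    walk-states w n                 ≡⟨ walk-states-end w ⟩
    walk-states w 0                 ≡⟨ cong (walk-states w) (n%n≡0 n) ⟨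
    walk-states w (n % n)           ≡⟨ cong (λ m → walk-states w (m % n)) ≡n ⟨
    walk-states w (suc (k % n) % n) ∎
  next : walk-states w (suc (toℕ (k mod n))) ≡ walk-states w (suc k % n)
  next = begin
    walk-states w (suc (toℕ (k mod n))) ≡⟨ cong (walk-states w ∘ suc) (toℕ-mod k n) ⟩
    walk-states w (suc (k % n))         ≡⟨ wrap ⟩
    walk-states w (suc (k % n) % n)     ≡⟨ cong (walk-states w) (suc-% k) ⟨
    walk-states w (suc k % n)           ∎

walk⇒blackWalk : {c : Vec Colour n} (i : Fin n) → lookup c i ≡ black → Walk r s c → BlackWalk r s c
walk⇒blackWalk zero    b (black w) = black w
walk⇒blackWalk (suc i) b (black w) = black w
walk⇒blackWalk (suc i) b (white w) = white (walk⇒blackWalk i b w)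

blackWalk⇒walk : {c : Vec Colour n} → BlackWalk r s c → Walk r s c
blackWalk⇒walk (black w) = black w
blackWalk⇒walk (white w) = white (blackWalk⇒walk w)

blackWalk⇒hasBlack : {c : Vec Colour n} → BlackWalk r s c → HasBlack c
blackWalk⇒hasBlack (black w) = zero , refl
blackWalk⇒hasBlack (white w) with i , b ← blackWalk⇒hasBlack w = suc i , b

-- The states are the parities of the distances to the next black bead. These distances are
-- periodic, so the walk closes up.
evenNecklace⇒closedWalk : .{{_ : NonZero n}} {c : Vec Colour n} → IsEvenNecklace c →
                          ∃[ s ] BlackWalk s s c
evenNecklace⇒closedWalk {n} {c} en@(evenNecklace b@(i , eq) _) =
  σ 0 , walk⇒blackWalk i eq (subst (λ r → Walk r (σ 0) c) σ-periodic (walk-intro steps c (⟨toℕ⟩ c)))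
  where
  gap : ∀ k → ∃[ d ] Gap (c ⟨_⟩) k d
  gap = gap-after c b
  σ : ℕ → Parity
  σ k = parity (proj₁ (gap k))
  steps : Steps (c ⟨_⟩) σ
  steps k = gap-step (evenNecklace⇒evenGaps c en) (proj₂ (gap k)) (proj₂ (gap (suc k)))
  σ-periodic : σ n ≡ σ 0
  σ-periodic = cong parity (gap-after-periodic c b)

closedWalk⇒evenNecklace : .{{_ : NonZero n}} {c : Vec Colour n} → BlackWalk s s c → IsEvenNecklace c
closedWalk⇒evenNecklace {c = c} w = evenGaps⇒evenNecklace c (blackWalk⇒hasBlack w)
  (steps⇒evenGaps (closedWalk-steps (blackWalk⇒walk w)))

a₂≡#closedBlackWalks : ∀ n → a₂ n ≡ #closedBlackWalks n
a₂≡#closedBlackWalks zero      = refl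
a₂≡#closedBlackWalks n@(suc _) = trans
  (count-cong {n} isEvenNecklace? (λ c → blackWalk? 0ℙ 0ℙ c ⊎-dec blackWalk? 1ℙ 1ℙ c) (to , from))
  (length-filter-∪ (blackWalk? 0ℙ 0ℙ) (blackWalk? 1ℙ 1ℙ) blackWalk-disjoint (colourings n))
  where
  to : ∀ {c : Vec Colour n} → IsEvenNecklace c → BlackWalk 0ℙ 0ℙ c ⊎ BlackWalk 1ℙ 1ℙ c
  to en with evenNecklace⇒closedWalk en
  ... | 0ℙ , w = inj₁ w
  ... | 1ℙ , w = inj₂ w
  from : ∀ {c : Vec Colour n} → BlackWalk 0ℙ 0ℙ c ⊎ BlackWalk 1ℙ 1ℙ c → IsEvenNecklace c
  from (inj₁ w) = closedWalk⇒evenNecklace w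
  from (inj₂ w) = closedWalk⇒evenNecklace w

-- Rational midpoints

toℚᵘ-/ : ∀ x m → toℚᵘ (x ℚ./ suc m) ≃ mkℚᵘ x m
toℚᵘ-/ x m = ℚ.toℚᵘ-fromℚᵘ (mkℚᵘ x m)

-- `mkℚᵘ` stores the denominator minus one, so the right-hand side is a fraction over 2 and its
-- numerator is the doubled midpoint.
toℚᵘ-midpoint : ∀ a h → toℚᵘ ((+ a) ℚ./ 1 ℚ.+ (+ h) ℚ./ 2) ≃ mkℚᵘ (+ (2 * a + h)) 1
toℚᵘ-midpoint a h = begin
  toℚᵘ ((+ a) ℚ./ 1 ℚ.+ (+ h) ℚ./ 2)           ≈⟨ ℚ.toℚᵘ-homo-+ ((+ a) ℚ./ 1) ((+ h) ℚ./ 2) ⟩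
  toℚᵘ ((+ a) ℚ./ 1) ℚᵘ.+ toℚᵘ ((+ h) ℚ./ 2)   ≈⟨ ℚᵘ.+-cong (toℚᵘ-/ (+ a) 0) (toℚᵘ-/ (+ h) 1) ⟩
  mkℚᵘ (+ a) 0 ℚᵘ.+ mkℚᵘ (+ h) 1               ≈⟨ *≡* (cong (ℤ._* + 2) num) ⟩
  mkℚᵘ (+ (2 * a + h)) 1                       ∎
  where
  open ℚᵘ.≃-Reasoning
  lemma : ∀ x y → x ℤ.* + 2 ℤ.+ y ℤ.* 1ℤ ≡ + 2 ℤ.* x ℤ.+ y
  lemma = ℤ-Solver.solve-∀
  num : + a ℤ.* + 2 ℤ.+ + h ℤ.* 1ℤ ≡ + (2 * a + h)
  num = trans (lemma (+ a) (+ h)) (cong (ℤ._+ + h) (sym (ℤ.pos-* 2 a)))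

module _ {p q : ℚ} {x y : ℤ} (p≃ : toℚᵘ p ≃ mkℚᵘ x 1) (q≃ : toℚᵘ q ≃ mkℚᵘ y 1) where

  private
    toℚᵘ-diff : toℚᵘ (p ℚ.- q) ≃ mkℚᵘ x 1 ℚᵘ.- mkℚᵘ y 1
    toℚᵘ-diff = ℚᵘ.≃-trans (ℚ.toℚᵘ-homo-+ p (ℚ.- q))
      (ℚᵘ.+-cong p≃ (ℚᵘ.≃-trans (ℚ.toℚᵘ-homo‿- q) (ℚᵘ.-‿cong q≃)))

    cross : ∀ x y → (x ℤ.* + 2 ℤ.+ (ℤ.- y) ℤ.* + 2) ℤ.* 1ℤ ≡ (x ℤ.- y) ℤ.* + 2
    cross = ℤ-Solver.solve-∀

    -- The unnormalised difference of two fractions over 2 has denominator 4.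
    cross′ : ∀ z → z ℤ.* + 4 ≡ z ℤ.* + 2 ℤ.* + 2
    cross′ = ℤ-Solver.solve-∀

  halves⁺ : ∀ z → x ℤ.- y ≡ z ℤ.* + 2 → p ℚ.- q ≡ z ℚ./ 1
  halves⁺ z eq = ℚ.toℚᵘ-injective (ℚᵘ.≃-trans toℚᵘ-diff (ℚᵘ.≃-trans
    (*≡* (trans (cross x y) (trans (cong (ℤ._* + 2) eq) (sym (cross′ z)))))
    (ℚᵘ.≃-sym (toℚᵘ-/ z 0))))

  halves⁻ : ∀ z → p ℚ.- q ≡ z ℚ./ 1 → x ℤ.- y ≡ z ℤ.* + 2
  halves⁻ z eq
    with *≡* e ← ℚᵘ.≃-trans (ℚᵘ.≃-sym toℚᵘ-diff) (ℚᵘ.≃-trans (ℚᵘ.≃-reflexive (cong toℚᵘ eq)) (toℚᵘ-/ z 0))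
    = ℤ.*-cancelʳ-≡ _ _ (+ 2) (trans (sym (cross x y)) (trans e (cross′ z)))

-- The multiple is moved to the side where it is nonnegative, so that a congruence becomes an
-- equality after shifting times forward by whole periods.
difference-multiple : ∀ {x y m} k → + x ℤ.- + y ≡ k ℤ.* + m ℤ.* + 2 →
                      ∃[ p ] ∃[ q ] x + 2 * (p * m) ≡ y + 2 * (q * m)
difference-multiple {x} {y} {m} (+ k) eq = 0 , k , ℤ.+-injective (begin
  + (x + 0)                              ≡⟨ cong +_ (+-identityʳ x) ⟩
  + x                                    ≡⟨ lemma (+ x) (+ y) ⟩
  + y ℤ.+ (+ x ℤ.- + y)                  ≡⟨ cong (ℤ._+_ (+ y)) eq ⟩
  + y ℤ.+ + k ℤ.* + m ℤ.* + 2            ≡⟨ cong (λ z → + y ℤ.+ z ℤ.* + 2) (ℤ.pos-* k m) ⟨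
  + y ℤ.+ + (k * m) ℤ.* + 2              ≡⟨ cong (ℤ._+_ (+ y)) (ℤ.*-comm (+ (k * m)) (+ 2)) ⟩
  + y ℤ.+ + 2 ℤ.* + (k * m)              ≡⟨ cong (ℤ._+_ (+ y)) (ℤ.pos-* 2 (k * m)) ⟨
  + (y + 2 * (k * m))                    ∎)
  where
  open ≡-Reasoning
  lemma : ∀ x y → x ≡ y ℤ.+ (x ℤ.- y)
  lemma = ℤ-Solver.solve-∀
difference-multiple {x} {y} {m} (-[1+ k ]) eq =
  let p , q , e = difference-multiple {y} {x} {m} (+ suc k) (begin
        + y ℤ.- + x                   ≡⟨ lemma (+ x) (+ y) ⟩
        ℤ.- (+ x ℤ.- + y)             ≡⟨ cong ℤ.-_ eq ⟩
        ℤ.- (-[1+ k ] ℤ.* + m ℤ.* + 2) ≡⟨ lemma₂ (+ suc k) (+ m) ⟩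
        + suc k ℤ.* + m ℤ.* + 2       ∎)
  in q , p , sym e
  where
  open ≡-Reasoning
  lemma : ∀ x y → y ℤ.- x ≡ ℤ.- (x ℤ.- y)
  lemma = ℤ-Solver.solve-∀
  lemma₂ : ∀ k m → ℤ.- ((ℤ.- k) ℤ.* m ℤ.* + 2) ≡ k ℤ.* m ℤ.* + 2
  lemma₂ = ℤ-Solver.solve-∀

-- Siteswap and sphericity conditions on the periodic extension

%≡⇒+ : ∀ {a b} .{{_ : NonZero n}} → a % n ≡ b % n → a + b / n * n ≡ b + a / n * n
%≡⇒+ {n} {a} {b} eq = begin
  a + b / n * n                   ≡⟨ cong (_+ b / n * n) (m≡m%n+[m/n]*n a n) ⟩
  a % n + a / n * n + b / n * n   ≡⟨ cong (λ r → r + a / n * n + b / n * n) eq ⟩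
  b % n + a / n * n + b / n * n   ≡⟨ lemma (b % n) (a / n * n) (b / n * n) ⟩
  b % n + b / n * n + a / n * n   ≡⟨ cong (_+ a / n * n) (m≡m%n+[m/n]*n b n) ⟨
  b + a / n * n                   ∎
  where
  open ≡-Reasoning
  lemma : ∀ x y z → x + y + z ≡ x + z + y
  lemma = ℕ-Solver.solve-∀

module _ .{{_ : NonZero n}} (t : Vec ℕ n) where

  ⟨toℕ+⟩ : ∀ i p → t ⟨ toℕ i + p * n ⟩ ≡ lookup t i
  ⟨toℕ+⟩ i p = trans (⟨⟩-cong t ([m+kn]%n≡m%n (toℕ i) p n)) (⟨toℕ⟩ t i)

  mod-toℕ+ : ∀ i p → (toℕ i + p * n) mod n ≡ i
  mod-toℕ+ i p = trans (mod-cong ([m+kn]%n≡m%n (toℕ i) p n)) (mod-toℕ i)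

  landing-mod : ∀ k → landing t (k mod n) ≡ (suc k + t ⟨ k ⟩) % n
  landing-mod k = %-+-congˡ (trans (cong (λ m → suc m % n) (toℕ-mod k n)) (sym (suc-% k))) (t ⟨ k ⟩)

  siteswap⁺ : (∀ k l → k + t ⟨ k ⟩ ≡ l + t ⟨ l ⟩ → k ≡ l) → IsSiteswap t
  siteswap⁺ inj {i} {j} eq = begin
    i                     ≡⟨ mod-toℕ+ i q ⟨
    (toℕ i + q * n) mod n ≡⟨ cong (_mod n) (inj _ _ (suc-injective shifted)) ⟩
    (toℕ j + p * n) mod n ≡⟨ mod-toℕ+ j p ⟩
    j                     ∎
    where
    open ≡-Reasoning
    p q : ℕ
    -- Each index is shifted by the other landing time's number of full periods; the landing times
    -- then agree exactly, whichever was larger.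
    p = (time i + lookup t i) / n
    q = (time j + lookup t j) / n
    lemma : ∀ x y z → x + y + z ≡ x + z + y
    lemma = ℕ-Solver.solve-∀
    shifted : time i + q * n + t ⟨ toℕ i + q * n ⟩ ≡ time j + p * n + t ⟨ toℕ j + p * n ⟩
    shifted = begin
      time i + q * n + t ⟨ toℕ i + q * n ⟩ ≡⟨ cong (_+_ (time i + q * n)) (⟨toℕ+⟩ i q) ⟩
      time i + q * n + lookup t i          ≡⟨ lemma (time i) (q * n) _ ⟩
      time i + lookup t i + q * n          ≡⟨ %≡⇒+ {n} eq ⟩
      time j + lookup t j + p * n          ≡⟨ lemma (time j) _ (p * n) ⟩
      time j + p * n + lookup t j          ≡⟨ cong (_+_ (time j + p * n)) (⟨toℕ+⟩ j p) ⟨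
      time j + p * n + t ⟨ toℕ j + p * n ⟩ ∎

  siteswap⁻ : IsSiteswap t → k + t ⟨ k ⟩ ≡ l + t ⟨ l ⟩ → k mod n ≡ l mod n
  siteswap⁻ {k} {l} inj eq = inj (begin
    landing t (k mod n)     ≡⟨ landing-mod k ⟩
    (suc k + t ⟨ k ⟩) % n   ≡⟨ cong (λ m → suc m % n) eq ⟩
    (suc l + t ⟨ l ⟩) % n   ≡⟨ landing-mod l ⟨
    landing t (l mod n)     ∎)
    where open ≡-Reasoning

  midpoint-cong⁻ : ∀ {i j} → midpoint t i ≡ midpoint t j [mod n ] →
                   ∃[ p ] ∃[ q ] 2 * time i + lookup t i + 2 * (p * n) ≡ 2 * time j + lookup t j + 2 * (q * n)
  midpoint-cong⁻ {i} {j} (k , eq) = difference-multiple {2 * time i + lookup t i} {2 * time j + lookup t j} {n} k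
    (halves⁻ (toℚᵘ-midpoint (time i) (lookup t i)) (toℚᵘ-midpoint (time j) (lookup t j)) (k ℤ.* + n) eq)

  spherical⁺ : (∀ k l → 2 * k + t ⟨ k ⟩ ≡ 2 * l + t ⟨ l ⟩ → k ≡ l) →
               ∀ i j → midpoint t i ≡ midpoint t j [mod n ] → i ≡ j
  spherical⁺ inj i j m≡ with midpoint-cong⁻ {i} {j} m≡
  ... | p , q , eq = begin
    i                     ≡⟨ mod-toℕ+ i p ⟨
    -- Times start from 1, so a doubled time exceeds the doubled index by the 2 cancelled here.
    (toℕ i + p * n) mod n ≡⟨ cong (_mod n) (inj _ _ (suc-injective (suc-injective shifted))) ⟩
    (toℕ j + q * n) mod n ≡⟨ mod-toℕ+ j q ⟩
    j                     ∎
    where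
    open ≡-Reasoning
    lemma : ∀ i h x → 2 + (2 * (i + x) + h) ≡ 2 * suc i + h + 2 * x
    lemma = ℕ-Solver.solve-∀
    shifted : 2 + (2 * (toℕ i + p * n) + t ⟨ toℕ i + p * n ⟩) ≡ 2 + (2 * (toℕ j + q * n) + t ⟨ toℕ j + q * n ⟩)
    shifted = begin
      2 + (2 * (toℕ i + p * n) + t ⟨ toℕ i + p * n ⟩) ≡⟨ cong (λ h → 2 + (2 * (toℕ i + p * n) + h)) (⟨toℕ+⟩ i p) ⟩
      2 + (2 * (toℕ i + p * n) + lookup t i)          ≡⟨ lemma (toℕ i) _ (p * n) ⟩
      2 * time i + lookup t i + 2 * (p * n)           ≡⟨ eq ⟩
      2 * time j + lookup t j + 2 * (q * n)           ≡⟨ lemma (toℕ j) _ (q * n) ⟨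
      2 + (2 * (toℕ j + q * n) + lookup t j)          ≡⟨ cong (λ h → 2 + (2 * (toℕ j + q * n) + h)) (⟨toℕ+⟩ j q) ⟨
      2 + (2 * (toℕ j + q * n) + t ⟨ toℕ j + q * n ⟩) ∎

  midpoint-cong⁺ : 2 * k + t ⟨ k ⟩ ≡ 2 * l + t ⟨ l ⟩ → midpoint t (k mod n) ≡ midpoint t (l mod n) [mod n ]
  midpoint-cong⁺ {k} {l} eq =
    -- Reducing `k` modulo `n` lowers its midpoint by `k / n` periods. The unreduced midpoints
    -- agree, so the reduced ones differ by this many periods.
    + (l / n) ℤ.- + (k / n) ,
    halves⁺ (toℚᵘ-midpoint (time (k mod n)) (t ⟨ k ⟩)) (toℚᵘ-midpoint (time (l mod n)) (t ⟨ l ⟩))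
      ((+ (l / n) ℤ.- + (k / n)) ℤ.* + n) (begin
      + (2 * time (k mod n) + t ⟨ k ⟩) ℤ.- + (2 * time (l mod n) + t ⟨ l ⟩)
        ≡⟨ cong₂ ℤ._-_ (reduce k) (reduce l) ⟩
      (+ 2 ℤ.+ + (2 * k + t ⟨ k ⟩) ℤ.- + 2 ℤ.* (+ (k / n) ℤ.* + n)) ℤ.- (+ 2 ℤ.+ + (2 * l + t ⟨ l ⟩) ℤ.- + 2 ℤ.* (+ (l / n) ℤ.* + n))
        ≡⟨ cong (λ x → (+ 2 ℤ.+ + x ℤ.- + 2 ℤ.* (+ (k / n) ℤ.* + n)) ℤ.- (+ 2 ℤ.+ + (2 * l + t ⟨ l ⟩) ℤ.- + 2 ℤ.* (+ (l / n) ℤ.* + n))) eq ⟩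
      (+ 2 ℤ.+ + (2 * l + t ⟨ l ⟩) ℤ.- + 2 ℤ.* (+ (k / n) ℤ.* + n)) ℤ.- (+ 2 ℤ.+ + (2 * l + t ⟨ l ⟩) ℤ.- + 2 ℤ.* (+ (l / n) ℤ.* + n))
        ≡⟨ lemma (+ (2 * l + t ⟨ l ⟩)) (+ (k / n)) (+ (l / n)) (+ n) ⟩
      (+ (l / n) ℤ.- + (k / n)) ℤ.* + n ℤ.* + 2 ∎)
    where
    open ≡-Reasoning
    lemma : ∀ x a b n → (+ 2 ℤ.+ x ℤ.- + 2 ℤ.* (a ℤ.* n)) ℤ.- (+ 2 ℤ.+ x ℤ.- + 2 ℤ.* (b ℤ.* n)) ≡ (b ℤ.- a) ℤ.* n ℤ.* + 2
    lemma = ℤ-Solver.solve-∀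
    lemma₂ : ∀ r q h → 2 * suc r + h + 2 * q ≡ 2 + (2 * (r + q) + h)
    lemma₂ = ℕ-Solver.solve-∀
    lemma₃ : ∀ x y → x ≡ x ℤ.+ y ℤ.- y
    lemma₃ = ℤ-Solver.solve-∀
    unwind : ∀ k → 2 * time (k mod n) + t ⟨ k ⟩ + 2 * (k / n * n) ≡ 2 + (2 * k + t ⟨ k ⟩)
    unwind k = begin
      2 * time (k mod n) + t ⟨ k ⟩ + 2 * (k / n * n)
        ≡⟨ cong (λ r → 2 * suc r + t ⟨ k ⟩ + 2 * (k / n * n)) (toℕ-mod k n) ⟩
      2 * suc (k % n) + t ⟨ k ⟩ + 2 * (k / n * n)
        ≡⟨ lemma₂ (k % n) (k / n * n) (t ⟨ k ⟩) ⟩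
      2 + (2 * (k % n + k / n * n) + t ⟨ k ⟩)
        ≡⟨ cong (λ m → 2 + (2 * m + t ⟨ k ⟩)) (m≡m%n+[m/n]*n k n) ⟨
      2 + (2 * k + t ⟨ k ⟩) ∎
    reduce : ∀ k → + (2 * time (k mod n) + t ⟨ k ⟩) ≡ + 2 ℤ.+ + (2 * k + t ⟨ k ⟩) ℤ.- + 2 ℤ.* (+ (k / n) ℤ.* + n)
    reduce k = begin
      + (2 * time (k mod n) + t ⟨ k ⟩)
        ≡⟨ lemma₃ _ (+ (2 * (k / n * n))) ⟩
      + (2 * time (k mod n) + t ⟨ k ⟩ + 2 * (k / n * n)) ℤ.- + (2 * (k / n * n))
        ≡⟨ cong₂ (λ x y → + x ℤ.- y) (unwind k)
             (trans (ℤ.pos-* 2 (k / n * n)) (cong (ℤ._*_ (+ 2)) (ℤ.pos-* (k / n) n))) ⟩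
      + 2 ℤ.+ + (2 * k + t ⟨ k ⟩) ℤ.- + 2 ℤ.* (+ (k / n) ℤ.* + n) ∎

-- The bijection

-- The second argument bounds the search for the next black bead; wait is junk if there is none
-- within the bound.
height : (ℕ → Colour) → ℕ → ℕ → ℕ
wait   : (ℕ → Colour) → ℕ → ℕ → ℕ

height f m k with f k
... | white = 1
... | black = 2 + wait f m (suc k)

wait f zero    k = 0
wait f (suc m) k with f k
... | black = 0
... | white = suc (wait f m (suc k))

wait-gap : ∀ {m} → Gap f k d → d ≤ m → wait f m k ≡ d
wait-gap {m = zero}  (stop b)   _         = refl
wait-gap {m = suc m} (stop b)   _         rewrite b = refl
wait-gap             (skip w g) (s≤s d≤m) rewrite w = cong suc (wait-gap g d≤m)

throws : .{{_ : NonZero n}} → Vec Colour n → Vec ℕ n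
throws {n} c = tabulate λ i → height (c ⟨_⟩) n (toℕ i)

colour : ℕ → Colour
-- A default value: throws of height 0 are excluded by `ThrowsAtEachStep`.
colour 0             = white
colour 1             = white
colour (suc (suc _)) = black

colour-height : ∀ m → colour (height f m k) ≡ f k
colour-height {f} {k} m with f k
... | white = refl
... | black = refl

vec-ext : ∀ {A : Set} {u v : Vec A n} → (∀ i → lookup u i ≡ lookup v i) → u ≡ v
vec-ext {u = u} {v} eq = trans (sym (tabulate∘lookup u)) (trans (tabulate-cong eq) (tabulate∘lookup v))

-- The balance equations telescope. For `g` the periodic distance to the next black bead, `g n`
-- cancels `g 0` and two balls remain.
sum-balance : ∀ {g : ℕ → ℕ} (t : Vec ℕ n) → (∀ i → lookup t i + g (toℕ i) ≡ 2 + g (suc (toℕ i))) →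
              sum t + g 0 ≡ 2 * n + g n
sum-balance []      eq = refl
sum-balance {suc n} {g} (x ∷ t) eq = begin
  x + sum t + g 0       ≡⟨ lemma₁ x (sum t) (g 0) ⟩
  x + g 0 + sum t       ≡⟨ cong (_+ sum t) (eq zero) ⟩
  2 + g 1 + sum t       ≡⟨ lemma₂ (sum t) (g 1) ⟩
  2 + (sum t + g 1)     ≡⟨ cong (_+_ 2) (sum-balance {g = g ∘ suc} t (eq ∘ suc)) ⟩
  2 + (2 * n + g (suc n)) ≡⟨ lemma₃ n (g (suc n)) ⟩
  2 * suc n + g (suc n) ∎
  where
  open ≡-Reasoning
  lemma₁ : ∀ x y z → x + y + z ≡ x + z + y
  lemma₁ = ℕ-Solver.solve-∀
  lemma₂ : ∀ x y → 2 + y + x ≡ 2 + (x + y)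
  lemma₂ = ℕ-Solver.solve-∀
  lemma₃ : ∀ x y → 2 + (2 * x + y) ≡ 2 * suc x + y
  lemma₃ = ℕ-Solver.solve-∀

sum-mono-≤ : (u v : Vec ℕ n) → (∀ i → lookup u i ≤ lookup v i) → sum u ≤ sum v
sum-mono-≤ []      []      _  = z≤n
sum-mono-≤ (x ∷ u) (y ∷ v) le = +-mono-≤ (le zero) (sum-mono-≤ u v (le ∘ suc))

-- A single strict inequality would make the sums differ. This upgrades the lower bound `throw-≤` to
-- an equality.
sum-≤-≡ : (u v : Vec ℕ n) → (∀ i → lookup u i ≤ lookup v i) → sum u ≡ sum v → u ≡ v
sum-≤-≡ []      []      _  _  = refl
sum-≤-≡ (x ∷ u) (y ∷ v) le eq with m≤n⇒m<n∨m≡n (le zero)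
... | inj₁ x<y  = contradiction eq (<⇒≢ (+-mono-<-≤ x<y (sum-mono-≤ u v (le ∘ suc))))
... | inj₂ refl = cong (x ∷_) (sum-≤-≡ u v (le ∘ suc) (+-cancelˡ-≡ x _ _ eq))

-- Throws of height at most 1 alone would sum to at most `n`.
large-throw : (t : Vec ℕ n) → n < sum t → ∃[ i ] colour (lookup t i) ≡ black
large-throw (suc (suc x) ∷ t) _     = zero , refl
large-throw (zero ∷ t)        n<s   with i , b ← large-throw t (<-trans (n<1+n _) n<s) = suc i , b
large-throw (suc zero ∷ t) (s≤s n<s) with i , b ← large-throw t n<s = suc i , b

colour-throws : .{{_ : NonZero n}} (c : Vec Colour n) → map colour (throws c) ≡ c
colour-throws {n} c = vec-ext λ i → begin
  lookup (map colour (throws c)) i        ≡⟨ lookup-map i colour (throws c) ⟩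
  colour (lookup (throws c) i)            ≡⟨ cong colour (lookup∘tabulate (height (c ⟨_⟩) n ∘ toℕ) i) ⟩
  colour (height (c ⟨_⟩) n (toℕ i))       ≡⟨ colour-height {c ⟨_⟩} {toℕ i} n ⟩
  c ⟨ toℕ i ⟩                             ≡⟨ ⟨toℕ⟩ c i ⟩
  lookup c i                              ∎
  where open ≡-Reasoning

throws-injective : .{{_ : NonZero n}} {c c′ : Vec Colour n} → throws c ≡ throws c′ → c ≡ c′
throws-injective {c = c} {c′} eq =
  trans (sym (colour-throws c)) (trans (cong (map colour) eq) (colour-throws c′))

module _ .{{_ : NonZero n}} (c : Vec Colour n) (hasBlack : HasBlack c) where

  throws-throw : ∀ k → Throw (c ⟨_⟩) k (throws c ⟨ k ⟩)
  throws-throw k =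
    subst (Throw (c ⟨_⟩) k) (sym (lookup∘tabulate (height (c ⟨_⟩) n ∘ toℕ) (k mod n)))
      (throw-shift (⟨⟩-shift c (trans (cong (_% n) (toℕ-mod k n)) (m%n%n≡m%n k n))) (at (toℕ (k mod n))))
    where
    at : ∀ k → Throw (c ⟨_⟩) k (height (c ⟨_⟩) n k)
    at k with c ⟨ k ⟩ in eq
    ... | white = white eq
    ... | black with d , g ← gap-after c hasBlack (suc k) =
      -- The search bound `n` suffices because a gap after a black bead has length at most `n - 1`.
      subst (Throw (c ⟨_⟩) k ∘ (_+_ 2)) (sym (wait-gap {m = n} g (≤-trans (gap-short c eq g) pred[n]≤n))) (black eq g)

  throws-throwᶠ : ∀ i → Throw (c ⟨_⟩) (toℕ i) (lookup (throws c) i)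
  throws-throwᶠ i = subst (Throw (c ⟨_⟩) (toℕ i)) (⟨toℕ⟩ (throws c) i) (throws-throw (toℕ i))

  throws-balls : HasBalls 2 (throws c)
  throws-balls = +-cancelʳ-≡ (g 0) _ _ (trans
    (sum-balance {g = g} (throws c) λ i →
      throw-balance (proj₂ (gap (toℕ i))) (proj₂ (gap (suc (toℕ i)))) (throws-throwᶠ i))
    (cong (_+_ (2 * n)) (gap-after-periodic c hasBlack)))
    where
    gap : ∀ k → ∃[ d ] Gap (c ⟨_⟩) k d
    gap = gap-after c hasBlack
    g : ℕ → ℕ
    g k = proj₁ (gap k)

  throws-positive : ThrowsAtEachStep (throws c)
  throws-positive i = throw-positive (throws-throwᶠ i)

  throws-siteswap : IsSiteswap (throws c)
  throws-siteswap = siteswap⁺ (throws c) λ k l → landing-injective (throws-throw k) (throws-throw l)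

  throws-spherical : EvenGaps (c ⟨_⟩) → IsSphericalSiteswap (throws c)
  throws-spherical even = record
    { siteswap  = throws-siteswap
    ; spherical = λ i j _ _ → spherical⁺ (throws c)
        (λ k l → midpoint-injective even (throws-throw k) (throws-throw l)) i j
    }

IsTwoBallSpherical : .{{_ : NonZero n}} → Vec ℕ n → Set
IsTwoBallSpherical t = IsSphericalSiteswap t × HasBalls 2 t × ThrowsAtEachStep t

throws-isTwoBallSpherical : .{{_ : NonZero n}} {c : Vec Colour n} → IsEvenNecklace c → IsTwoBallSpherical (throws c)
throws-isTwoBallSpherical {c = c} en =
  throws-spherical c b (evenNecklace⇒evenGaps c en) , throws-balls c b , throws-positive c b
  where b = IsEvenNecklace.someBlack en

-- Recovering a siteswap from its colours

module _ .{{_ : NonZero n}} (t : Vec ℕ n) (positive : ThrowsAtEachStep t) where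

  private
    c : Vec Colour n
    c = map colour t

    colour-at : ∀ k → c ⟨ k ⟩ ≡ colour (t ⟨ k ⟩)
    colour-at k = lookup-map (k mod n) colour t

    white-throw : ∀ {k} → c ⟨ k ⟩ ≡ white → t ⟨ k ⟩ ≡ 1
    white-throw {k} w with t ⟨ k ⟩ | positive (k mod n) | trans (sym (colour-at k)) w
    ... | 1 | _ | _ = refl

  throw-≤ : IsSiteswap t → ∀ {k h} → Throw (c ⟨_⟩) k h → h ≤ t ⟨ k ⟩
  throw-≤ ss {k} (white _) = positive (k mod n)
  throw-≤ ss {k} (black {d = d} b g) with t ⟨ k ⟩ in eq | trans (sym (colour-at k)) b
  -- The height is `2 + x`. If `x < d`, the white bead `suc k + x` throws to the same landing time,
  -- so it would coincide modulo `n` with the black bead `k`.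
  ... | suc (suc x) | _ = s≤s (s≤s (≮⇒≥ λ x<d →
    let w = gap-white g x<d in
    black≢white b (trans (cong (lookup c) (siteswap⁻ t {k} {suc k + x} ss (begin
      k + t ⟨ k ⟩                   ≡⟨ cong (_+_ k) eq ⟩
      k + (2 + x)                   ≡⟨ lemma k x ⟩
      suc k + x + 1                 ≡⟨ cong (_+_ (suc k + x)) (white-throw w) ⟨
      suc k + x + t ⟨ suc k + x ⟩   ∎))) w)))
    where
    open ≡-Reasoning
    lemma : ∀ k x → k + (2 + x) ≡ suc k + x + 1
    lemma = ℕ-Solver.solve-∀

  hasBlack : HasBalls 2 t → HasBlack c
  hasBlack balls with i , b ← large-throw t (subst (n <_) (sym balls) (m<m+n n (subst (0 <_) (sym (+-identityʳ n)) (>-nonZero⁻¹ n)))) =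
    i , trans (lookup-map i colour t) b

  throws-colours : IsSiteswap t → HasBalls 2 t → throws c ≡ t
  throws-colours ss balls = sum-≤-≡ (throws c) t
    (λ i → subst (lookup (throws c) i ≤_) (⟨toℕ⟩ t i) (throw-≤ ss (throws-throwᶠ c b i)))
    (trans (throws-balls c b) (sym balls))
    where b = hasBlack balls

  colours-evenGaps : IsSphericalSiteswap t → HasBalls 2 t → EvenGaps (c ⟨_⟩)
  colours-evenGaps sph balls {k} {d} b g with halve d
    where
    halve : ∀ d → ∃[ m ] (d ≡ m * 2 ⊎ d ≡ suc (m * 2))
    halve zero    = 0 , inj₁ refl
    halve (suc d) with halve d
    ... | m , inj₁ e = m , inj₂ (cong suc e)
    ... | m , inj₂ e = suc m , inj₁ (cong suc e)
  ... | m , inj₁ d≡ = divides m d≡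
  -- For `d = 2m + 1` the throws at `k` and `suc k + m` share the doubled midpoint 2k + 2m + 3, and
  -- sphericity identifies a black bead with a white one.
  ... | m , inj₂ d≡ = contradiction (trans (cong (lookup c) same) w) (black≢white b)
    where
    open ≡-Reasoning
    open IsSphericalSiteswap sph
    w : c ⟨ suc k + m ⟩ ≡ white
    w = gap-white g (subst (m <_) (sym d≡) (s≤s (m≤m*n m 2)))
    -- The exact height, beyond the lower bound, comes from the comparison of sums in
    -- `throws-colours`.
    t≡ : t ⟨ k ⟩ ≡ 2 + d
    t≡ = trans (cong (_⟨ k ⟩) (sym (throws-colours siteswap balls)))
               (throw-unique (throws-throw c (hasBlack balls) k) (black b g))
    lemma : ∀ k m → 2 * k + (2 + suc (m * 2)) ≡ 2 * (suc k + m) + 1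
    lemma = ℕ-Solver.solve-∀
    nonzero : ∀ i → lookup t i ≢ 0
    nonzero i eq = contradiction (positive i) (subst (λ x → ¬ x ≥ 1) (sym eq) λ ())
    same : k mod n ≡ (suc k + m) mod n
    same = spherical _ _ (nonzero _) (nonzero _) (midpoint-cong⁺ t {k} {suc k + m} (begin
      2 * k + t ⟨ k ⟩                       ≡⟨ cong (_+_ (2 * k)) t≡ ⟩
      2 * k + (2 + d)                       ≡⟨ cong (λ d → 2 * k + (2 + d)) d≡ ⟩
      2 * k + (2 + suc (m * 2))             ≡⟨ lemma k m ⟩
      2 * (suc k + m) + 1                   ≡⟨ cong (_+_ (2 * (suc k + m))) (white-throw w) ⟨
      2 * (suc k + m) + t ⟨ suc k + m ⟩     ∎))

isTwoBallSpherical⇒throws : .{{_ : NonZero n}} {t : Vec ℕ n} → IsTwoBallSpherical t → ∃[ c ] IsEvenNecklace c × t ≡ throws c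
isTwoBallSpherical⇒throws {t = t} (sph , balls , positive) = map colour t ,
  evenGaps⇒evenNecklace _ (hasBlack t positive balls) (colours-evenGaps t positive sph balls) ,
  sym (throws-colours t positive (IsSphericalSiteswap.siteswap sph) balls)

siteswaps : ∀ n .{{_ : NonZero n}} → Enumeration (IsTwoBallSpherical {n})
siteswaps n .elements = List.map throws (evenNecklaces n .elements)
siteswaps n .unique   = Unique.map⁺ throws-injective (evenNecklaces n .unique)
siteswaps n .exact t  = mk⇔
  (λ t∈ → let c , c∈ , t≡ = ∈-map⁻ throws t∈ in
    subst IsTwoBallSpherical (sym t≡) (throws-isTwoBallSpherical (Equivalence.to (evenNecklaces n .exact c) c∈)))
  (λ good → let c , en , t≡ = isTwoBallSpherical⇒throws good in
    subst (_∈ List.map throws (evenNecklaces n .elements)) (sym t≡) (∈-map⁺ throws (Equivalence.from (evenNecklaces n .exact c) en)))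

mainTheorem5 : (∀ (n : ℕ) .{{_ : NonZero n}} →
    HasCardinality
    (λ (t : Vec ℕ n) → IsSphericalSiteswap t × HasBalls 2 t × ThrowsAtEachStep t)
    (a₂ n))
    × (a₂ 0 ≡ 0)
    × (a₂ 1 ≡ 1)
    × (∀ (n : ℕ) → n ≥ 2 →
    + a₂ n ≡ + a₂ (n ∸ 1) ℤ.+ + a₂ (n ∸ 2) ℤ.+ 1ℤ ℤ.- -1ℤ ℤ.^ n)
    × (∀ (n : ℕ) → + a₂ n ≡ associatedMersenne n)
mainTheorem5 =
    (λ n → siteswaps n , length-map throws (evenNecklaces n .elements))
  , refl
  , refl
  , (λ { (suc zero) (s≤s ()) ; (suc (suc n)) _ → a₂-rec n })
  , a₂-associatedMersenne
  where
  a₂-rec : ∀ n → + a₂ (2 + n) ≡ + a₂ (1 + n) ℤ.+ + a₂ n ℤ.+ 1ℤ ℤ.- -1ℤ ℤ.^ (2 + n)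
  a₂-rec n = trans (cong +_ (a₂≡#closedBlackWalks (2 + n))) (trans (+#closedBlackWalks-rec n)
    (cong₂ (λ x y → + x ℤ.+ + y ℤ.+ 1ℤ ℤ.- -1ℤ ℤ.^ (2 + n))
      (sym (a₂≡#closedBlackWalks (1 + n))) (sym (a₂≡#closedBlackWalks n))))

  a₂-associatedMersenne : ∀ n → + a₂ n ≡ associatedMersenne n
  a₂-associatedMersenne zero          = refl
  a₂-associatedMersenne (suc zero)    = refl
  a₂-associatedMersenne (suc (suc n)) = trans (a₂-rec n)
    (cong₂ (λ x y → x ℤ.+ y ℤ.+ 1ℤ ℤ.- -1ℤ ℤ.^ (2 + n))
      (a₂-associatedMersenne (suc n)) (a₂-associatedMersenne n))
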